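{- The class of finite simple graphs $\{ G \mid c_2(G)\leq 2 \}$ is the class of $\mathcal{F}$-free graphs, where \[\mathcal{F}=\{P_4,\; P_3+K_2,\; 3K_2,\; \text{full house},\; \text{dart},\; \ltimes,\; K_{3,3},\; W_5\}.\] That is, for every finite simple graph $G$, $c_2(G)\leq 2$ if and only if no induced subgraph of $G$ is isomorphic to a graph in $\mathcal{F}$.
   Context: All graphs are finite and simple. A subgraph complementation system for a graph $G=(V,E)$ is a finite collection (family) $\mathscr{C}$ of subsets of $V$ such that, for any two distinct vertices $u,v\in V$, $uv\in E$ if and only if $u$ and $v$ appear together in an odd number of sets in $\mathscr{C}$. The subgraph complementation number $c_2(G)$ is the minimum cardinality of a subgraph complementation system for $G$. Notation: $P_n$ is the path on $n$ vertices, $K_n$ the complete graph on $n$ vertices, $K_{3,3}$ the complete bipartite graph with both parts of size 3; $G+H$ denotes disjoint union and $3K_2$ is the disjoint union of three copies of $K_2$; $W_5$ is the wheel on 5 vertices in total (a 4-cycle together with one further vertex adjacent to all four vertices of the cycle). The remaining graphs each have vertex set $\{0,1,2,3,4\}$: the full house has edges $01,04,12,13,14,23,24,34$ (a $K_4$ on $\{1,2,3,4\}$ plus a vertex $0$ adjacent to exactly $1$ and $4$); the dart has edges $01,03,04,13,14,12$ ($K_4$ minus the edge $34$ on $\{0,1,3,4\}$, plus a pendant vertex $2$ attached to the vertex $1$, which has degree 3 in that $K_4$ minus an edge); $\ltimes$ has edges $01,12,02,23,24$ (a triangle with two pendant vertices attached to the same vertex of the triangle). -}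

module Defs where

open import Level using (0ℓ)
open import Data.Bool.Base using (Bool; true; false)
import Data.Bool.Properties as Bool
open import Data.Fin.Base using (Fin; toℕ; splitAt)
open import Data.Fin.Patterns using (0F; 1F; 2F; 3F; 4F)
open import Data.Fin.Properties using (_≟_; all?)
open import Data.Fin.Subset using (Subset; _∈_; ⁅_⁆; _∪_)
open import Data.Fin.Subset.Properties
  using (_∈?_; anySubset?; x∈⁅x⁆; x∈⁅y⁆⇒x≡y; x∈p∪q⁺; x∈p∪q⁻)
open import Data.List.Base using (List; []; _∷_; length; filter; allFin; cartesianProduct)
open import Data.List.Properties using (filter-accept; filter-reject; filter-≐)
open import Data.List.Membership.Propositional using () renaming (_∈_ to _∈ₗ_)
open import Data.List.Membership.Propositional.Properties using (∈-allFin; ∈-cartesianProduct⁺)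
import Data.List.Membership.DecPropositional as DecMembership
open import Data.List.Relation.Unary.All as All using (All; []; _∷_)
open import Data.Nat.Base as ℕ using (ℕ; zero; suc; _+_; _≤_; z≤n; s≤s; parity)
import Data.Nat.Properties as ℕ
open import Data.Parity.Base using (Parity; 0ℙ; 1ℙ)
import Data.Parity.Properties as ℙ
open import Data.Product.Base using (Σ; ∃; _×_; _,_; proj₁; proj₂; swap)
open import Data.Product.Properties using (≡-dec)
open import Data.Sum.Base as Sum using (_⊎_; inj₁; inj₂; [_,_])
open import Data.Sum.Relation.Binary.Pointwise
  using (Pointwise; inj₁; inj₂; ⊎-decidable; ⊎-symmetric)
open import Function.Base using (_∘_; _on_; const; case_of_)
open import Function.Bundles using (_⇔_; _↔_; mk⇔; Equivalence; Inverse)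
open import Relation.Binary.Core using (Rel)
open import Relation.Binary.Definitions using (Decidable; Symmetric)
open import Relation.Binary.PropositionalEquality
  using (_≡_; _≢_; refl; sym; trans; cong; subst; ≢-sym)
open import Relation.Nullary using (¬_; Dec; yes; no; contradiction)
open import Relation.Nullary.Decidable
  using (map′; ¬?; True; toWitness; _×-dec_; _⊎-dec_; _→-dec_)
import Relation.Unary as Unary

private
  variable
    m n : ℕ
    V W : Set

-- Adjacency is decidable, as for every finite graph classically; a finite
-- simple graph on n vertices is a Graph (Fin n).

record Graph (V : Set) : Set₁ where
  field
    Adj       : Rel V 0ℓ
    adj?      : Decidable Adj
    symmetric : Symmetric Adj
    loopless  : ∀ v → ¬ Adj v v

open Graph public

infix 4 _≅_

_≅_ : Graph V → Graph W → Set
_≅_ {V} {W} G H =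
  Σ (V ↔ W) λ f → ∀ u v → Adj G u v ⇔ Adj H (Inverse.to f u) (Inverse.to f v)

induced : Graph (Fin n) → (S : Subset n) → Graph (∃ λ v → v ∈ S)
induced G S = record
  { Adj       = Adj G on proj₁
  ; adj?      = λ u v → adj? G (proj₁ u) (proj₁ v)
  ; symmetric = symmetric G
  ; loopless  = λ v → loopless G (proj₁ v)
  }

FiniteGraph : Set₁
FiniteGraph = ∃ λ n → Graph (Fin n)

_-free : List FiniteGraph → Graph (Fin n) → Set₁
(𝓗 -free) G = All (λ (_ , H) → ∀ S → ¬ (induced G S ≅ H)) 𝓗

together? : ∀ (u v : Fin n) → Unary.Decidable (λ S → u ∈ S × v ∈ S)
together? u v S = (u ∈? S) ×-dec (v ∈? S)

togetherCount : Fin n → Fin n → List (Subset n) → ℕ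
togetherCount u v 𝒞 = length (filter (together? u v) 𝒞)

Odd : ℕ → Set
Odd k = parity k ≡ 1ℙ

-- A collection of subsets is a list, so repetitions are permitted;
-- its cardinality is the length of the list.

IsSystem : Graph (Fin n) → List (Subset n) → Set
IsSystem G 𝒞 = ∀ u v → u ≢ v → Adj G u v ⇔ Odd (togetherCount u v 𝒞)

HasSystemOfSize : Graph (Fin n) → ℕ → Set
HasSystemOfSize G k = ∃ λ 𝒞 → length 𝒞 ≡ k × IsSystem G 𝒞

private
  infixr 2 _⇔-dec_

  _⇔-dec_ : ∀ {A B : Set} → Dec A → Dec B → Dec (A ⇔ B)
  a? ⇔-dec b? = map′ (λ (f , g) → mk⇔ f g)
                     (λ e → Equivalence.to e , Equivalence.from e)
                     ((a? →-dec b?) ×-dec (b? →-dec a?))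

  odd? : ∀ k → Dec (Odd k)
  odd? k = parity k ℙ.≟ 1ℙ

  isSystem? : (G : Graph (Fin n)) → Unary.Decidable (IsSystem G)
  isSystem? G 𝒞 = all? λ u → all? λ v →
    ¬? (u ≟ v) →-dec (adj? G u v ⇔-dec odd? (togetherCount u v 𝒞))

  anyList? : {P : List (Subset n) → Set} → Unary.Decidable P →
             ∀ k → Dec (∃ λ 𝒞 → length 𝒞 ≡ k × P 𝒞)
  anyList? P? zero =
    map′ (λ p → [] , refl , p) (λ { ([] , _ , p) → p }) (P? [])
  anyList? P? (suc k) =
    map′ (λ { (S , 𝒞 , eq , p) → S ∷ 𝒞 , cong suc eq , p })
         (λ { (S ∷ 𝒞 , eq , p) → S , 𝒞 , ℕ.suc-injective eq , p })
         (anySubset? λ S → anyList? (P? ∘ (S ∷_)) k)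

hasSystemOfSize? : (G : Graph (Fin n)) → Unary.Decidable (HasSystemOfSize G)
hasSystemOfSize? G = anyList? (isSystem? G)

private
  Agrees : Graph (Fin n) → List (Subset n) → Fin n × Fin n → Set
  Agrees G 𝒞 (u , v) = u ≢ v → Adj G u v ⇔ Odd (togetherCount u v 𝒞)

  togetherCount-comm : ∀ (u v : Fin n) 𝒞 → togetherCount u v 𝒞 ≡ togetherCount v u 𝒞
  togetherCount-comm u v 𝒞 =
    cong length (filter-≐ (together? u v) (together? v u) (swap , swap) 𝒞)

  agrees-swap : ∀ (G : Graph (Fin n)) 𝒞 {u v} → Agrees G 𝒞 (u , v) → Agrees G 𝒞 (v , u)
  agrees-swap G 𝒞 {u} {v} ok v≢u = mk⇔
    (subst Odd (togetherCount-comm u v 𝒞) ∘ Equivalence.to (ok (v≢u ∘ sym)) ∘ symmetric G)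
    (symmetric G ∘ Equivalence.from (ok (v≢u ∘ sym)) ∘ subst Odd (togetherCount-comm v u 𝒞))

  pair-elim : ∀ (a b : Fin n) {u v} → u ≢ v →
              u ∈ ⁅ a ⁆ ∪ ⁅ b ⁆ → v ∈ ⁅ a ⁆ ∪ ⁅ b ⁆ →
              (u ≡ a × v ≡ b) ⊎ (u ≡ b × v ≡ a)
  pair-elim a b u≢v u∈ v∈
    with Sum.map (x∈⁅y⁆⇒x≡y a) (x∈⁅y⁆⇒x≡y b) (x∈p∪q⁻ ⁅ a ⁆ ⁅ b ⁆ u∈)
       | Sum.map (x∈⁅y⁆⇒x≡y a) (x∈⁅y⁆⇒x≡y b) (x∈p∪q⁻ ⁅ a ⁆ ⁅ b ⁆ v∈)
  ... | inj₁ p | inj₁ q = contradiction (trans p (sym q)) u≢v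
  ... | inj₁ p | inj₂ q = inj₁ (p , q)
  ... | inj₂ p | inj₁ q = inj₂ (p , q)
  ... | inj₂ p | inj₂ q = contradiction (trans p (sym q)) u≢v

  odd-suc : ∀ k → Odd (suc k) ⇔ (¬ Odd k)
  odd-suc k with parity (suc k) | parity k | ℙ.suc-homo-⁻¹ k
  ... | 0ℙ | 1ℙ | _ = mk⇔ (λ ()) (λ ¬p → contradiction refl ¬p)
  ... | 1ℙ | 0ℙ | _ = mk⇔ (λ _ ()) (λ _ → refl)

  flip-odd : ∀ {A : Set} k → Dec A → ¬ (A ⇔ Odd k) → A ⇔ Odd (suc k)
  flip-odd k a? ne with a? | odd? k
  ... | yes a | yes o = contradiction (mk⇔ (const o) (const a)) ne
  ... | yes a | no ¬o = mk⇔ (const (Equivalence.from (odd-suc k) ¬o)) (const a)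
  ... | no ¬a | yes o = mk⇔ (λ a → contradiction a ¬a)
                            (λ o′ → contradiction o (Equivalence.to (odd-suc k) o′))
  ... | no ¬a | no ¬o = contradiction
    (mk⇔ (λ a → contradiction a ¬a) (λ o → contradiction o ¬o)) ne

  -- Treat the pairs one at a time; adding {a , b} to the collection
  -- changes the parity of no pair other than {a , b}.

  agreeing : (G : Graph (Fin n)) (ps : List (Fin n × Fin n)) →
             ∃ λ 𝒞 → All (Agrees G 𝒞) ps
  agreeing G [] = [] , []
  agreeing G ((a , b) ∷ ps) with agreeing G ps
  ... | 𝒞 , oks with a ≟ b
  ...   | yes a≡b = 𝒞 , (λ a≢b → contradiction a≡b a≢b) ∷ oks
  ...   | no  a≢b with adj? G a b ⇔-dec odd? (togetherCount a b 𝒞)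
  ...     | yes ok = 𝒞 , const ok ∷ oks
  ...     | no ¬ok = S ∷ 𝒞 , const fixed ∷ All.map kept oks
    where
    S = ⁅ a ⁆ ∪ ⁅ b ⁆

    fixed : Adj G a b ⇔ Odd (togetherCount a b (S ∷ 𝒞))
    fixed = subst (λ xs → Adj G a b ⇔ Odd (length xs))
      (sym (filter-accept (together? a b) {S} {𝒞}
        (x∈p∪q⁺ (inj₁ (x∈⁅x⁆ a)) , x∈p∪q⁺ (inj₂ (x∈⁅x⁆ b)))))
      (flip-odd (togetherCount a b 𝒞) (adj? G a b) ¬ok)

    kept : ∀ {p} → Agrees G 𝒞 p → Agrees G (S ∷ 𝒞) p
    kept {u , v} ok u≢v = subst (λ xs → Adj G u v ⇔ Odd (length xs))
      (sym (filter-reject (together? u v) {S} {𝒞} λ (u∈ , v∈) →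
        case pair-elim a b u≢v u∈ v∈ of λ where
          (inj₁ (refl , refl)) → ¬ok (ok u≢v)
          (inj₂ (refl , refl)) → ¬ok (agrees-swap G 𝒞 ok a≢b)))
      (ok u≢v)

system-exists : (G : Graph (Fin n)) → ∃ (HasSystemOfSize G)
system-exists {n} G with agreeing G (cartesianProduct (allFin n) (allFin n))
... | 𝒞 , oks = length 𝒞 , 𝒞 , refl , λ u v →
  All.lookup oks (∈-cartesianProduct⁺ (∈-allFin u) (∈-allFin v))

Least : (ℕ → Set) → ℕ → Set
Least P k = P k × (∀ j → P j → k ≤ j)

least : {P : ℕ → Set} → Unary.Decidable P → ∀ k → P k → ∃ (Least P)
least P? zero p = zero , p , λ _ _ → z≤n
least P? (suc k) p with P? zero
... | yes p₀ = zero , p₀ , λ _ _ → z≤n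
... | no ¬p₀ with least (P? ∘ suc) k p
...   | j , pj , min = suc j , pj , λ where
  zero    p₀ → contradiction p₀ ¬p₀
  (suc i) pi → s≤s (min i pi)

least-system : (G : Graph (Fin n)) → ∃ (Least (HasSystemOfSize G))
least-system G with system-exists G
... | k , p = least (hasSystemOfSize? G) k p

c₂ : Graph (Fin n) → ℕ
c₂ G = proj₁ (least-system G)

c₂-least : (G : Graph (Fin n)) → Least (HasSystemOfSize G) (c₂ G)
c₂-least G = proj₂ (least-system G)

P : ∀ n → Graph (Fin n)
P n = record
  { Adj       = λ u v → suc (toℕ u) ≡ toℕ v ⊎ suc (toℕ v) ≡ toℕ u
  ; adj?      = λ u v → (suc (toℕ u) ℕ.≟ toℕ v) ⊎-dec (suc (toℕ v) ℕ.≟ toℕ u)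
  ; symmetric = Sum.swap
  ; loopless  = λ _ → [ ℕ.1+n≢n , ℕ.1+n≢n ]
  }

K : ∀ n → Graph (Fin n)
K n = record
  { Adj       = _≢_
  ; adj?      = λ u v → ¬? (u ≟ v)
  ; symmetric = ≢-sym
  ; loopless  = λ _ v≢v → v≢v refl
  }

K[_,_] : ∀ m n → Graph (Fin (m + n))
K[ m , n ] = record
  { Adj       = λ u v → inFirst u ≢ inFirst v
  ; adj?      = λ u v → ¬? (inFirst u Bool.≟ inFirst v)
  ; symmetric = ≢-sym
  ; loopless  = λ _ v≢v → v≢v refl
  }
  where
  inFirst : Fin (m + n) → Bool
  inFirst v = [ const true , const false ] (splitAt m v)

infixr 6 _⊕_

-- Disjoint union: the first m vertices carry G and the last n carry H.

_⊕_ : Graph (Fin m) → Graph (Fin n) → Graph (Fin (m + n))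
_⊕_ {m} G H = record
  { Adj       = Pointwise (Adj G) (Adj H) on splitAt m
  ; adj?      = λ u v → ⊎-decidable (adj? G) (adj? H) (splitAt m u) (splitAt m v)
  ; symmetric = ⊎-symmetric (symmetric G) (symmetric H)
  ; loopless  = λ v → noLoop (splitAt m v)
  }
  where
  noLoop : ∀ x → ¬ Pointwise (Adj G) (Adj H) x x
  noLoop (inj₁ x) (inj₁ e) = loopless G x e
  noLoop (inj₂ y) (inj₂ e) = loopless H y e

fromEdges : (es : List (Fin n × Fin n)) →
            {True (All.all? (λ (u , v) → ¬? (u ≟ v)) es)} → Graph (Fin n)
fromEdges {n} es {irr} = record
  { Adj       = λ u v → (u , v) ∈ₗ es ⊎ (v , u) ∈ₗ es
  ; adj?      = λ u v → ((u , v) ∈ₗ? es) ⊎-dec ((v , u) ∈ₗ? es)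
  ; symmetric = Sum.swap
  ; loopless  = λ _ → [ noLoop , noLoop ]
  }
  where
  open DecMembership (≡-dec (_≟_ {n}) (_≟_ {n})) renaming (_∈?_ to _∈ₗ?_) using ()

  noLoop : ∀ {v} → ¬ (v , v) ∈ₗ es
  noLoop v∈ = All.lookup (toWitness irr) v∈ refl

fullHouse dart ⋉ W₅ : Graph (Fin 5)

fullHouse = fromEdges
  ( (0F , 1F) ∷ (0F , 4F) ∷ (1F , 2F) ∷ (1F , 3F)
  ∷ (1F , 4F) ∷ (2F , 3F) ∷ (2F , 4F) ∷ (3F , 4F) ∷ [])

dart = fromEdges
  ((0F , 1F) ∷ (0F , 3F) ∷ (0F , 4F) ∷ (1F , 3F) ∷ (1F , 4F) ∷ (1F , 2F) ∷ [])

⋉ = fromEdges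
  ((0F , 1F) ∷ (1F , 2F) ∷ (0F , 2F) ∷ (2F , 3F) ∷ (2F , 4F) ∷ [])

-- The 4-cycle 0 1 2 3 and the hub 4.

W₅ = fromEdges
  ( (0F , 1F) ∷ (1F , 2F) ∷ (2F , 3F) ∷ (3F , 0F)
  ∷ (4F , 0F) ∷ (4F , 1F) ∷ (4F , 2F) ∷ (4F , 3F) ∷ [])

𝓕 : List FiniteGraph
𝓕 = (_ , P 4)
  ∷ (_ , P 3 ⊕ K 2)
  ∷ (_ , K 2 ⊕ K 2 ⊕ K 2)
  ∷ (_ , fullHouse)
  ∷ (_ , dart)
  ∷ (_ , ⋉)
  ∷ (_ , K[ 3 , 3 ])
  ∷ (_ , W₅)
  ∷ []

{-# OPTIONS --safe #-}
module Submission where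

-- A graph has a system of two sets S₁, S₂ exactly when, apart from isolated
-- vertices, it is the join of an independent set (S₁ ∩ S₂) with the disjoint
-- union of two cliques (S₁ ∖ S₂ and S₂ ∖ S₁).  In an 𝓕-free graph each vertex
-- is put into one of these parts according to its adjacencies to an induced
-- path x – y – z, if there is one; without induced paths on three vertices the
-- graph is a disjoint union of cliques.  The path may fit in two ways: either
-- y is central, or x and z are.  A fourth vertex making an induced claw or
-- diamond with the path rules out the first way; without induced claws and
-- diamonds the first way always works.

open import Defs
open import Data.Bool.Base using (Bool; true; false; if_then_else_; _∧_)
import Data.Bool.Properties as Bool
open import Data.Empty using (⊥; ⊥-elim)
open import Data.Nat.Base using (ℕ; suc; _≤_; _<_; s≤s)
open import Data.Nat.Properties using (allUpTo?)
open import Data.Fin.Base using (Fin)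
open import Data.Fin.Properties using (_≟_; all?; any?)
open import Data.Fin.Subset using (Subset; _∈_)
open import Data.Fin.Subset.Properties using (_∈?_)
open import Data.List.Base using ([]; _∷_; allFin)
import Data.List.Base as List
open import Data.List.Properties using (length-map)
open import Data.List.Membership.Propositional using () renaming (_∈_ to _∈ₗ_)
open import Data.List.Membership.Propositional.Properties using (∈-allFin)
open import Data.List.Relation.Unary.All as All using (All; []; _∷_)
open import Data.List.Relation.Unary.AllPairs.Core using (AllPairs; []; _∷_)
open import Data.List.Relation.Unary.Any using (here; there)
open import Data.Product.Base using (∃; _×_; _,_; proj₁; proj₂)
open import Data.Sum.Base using (_⊎_; inj₁; inj₂)
open import Data.Vec.Base using (Vec; []; _∷_; lookup; tabulate)
open import Data.Vec.Properties using (lookup∘tabulate; lookup⇒[]=; []=⇒lookup)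
open import Data.Vec.Properties.WithK using ([]=-irrelevant)
open import Function.Base using (_∘_; id; const)
open import Function.Bundles using (_⇔_; mk⇔; mk↔ₛ′; Equivalence; Inverse)
open import Relation.Binary.PropositionalEquality
  using (_≡_; _≢_; refl; sym; trans; cong; cong₂; subst; subst₂; ≢-sym)
open import Relation.Nullary using (¬_; Dec; does; yes; no; contradiction)
open import Relation.Nullary.Decidable
  using (¬?; from-yes; dec-true; does-⇔; decidable-stable; _×-dec_; _⊎-dec_)

private
  variable
    m n : ℕ

∈-proj₁-injective : ∀ {S : Subset n} {u v : ∃ λ v → v ∈ S} → proj₁ u ≡ proj₁ v → u ≡ v
∈-proj₁-injective {u = v , v∈S} {.v , v∈S′} refl = cong (v ,_) ([]=-irrelevant v∈S v∈S′)

-- Subgraph complementation systems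

does-∈? : ∀ (v : Fin n) S → does (v ∈? S) ≡ lookup S v
does-∈? Fin.zero    (true  ∷ S) = refl
does-∈? Fin.zero    (false ∷ S) = refl
does-∈? (Fin.suc v) (_     ∷ S) = does-∈? v S

-- `filter` decides membership through `∈?`; phrased with `lookup`, the count simplifies for sets
-- built by `tabulate`.
togetherCount-∷ : ∀ (u v : Fin n) S 𝒞 → togetherCount u v (S ∷ 𝒞) ≡
  (if lookup S u ∧ lookup S v then suc else id) (togetherCount u v 𝒞)
togetherCount-∷ u v S 𝒞
  rewrite sym (does-∈? u S) | sym (does-∈? v S)
  with does (u ∈? S) ∧ does (v ∈? S)
... | true  = refl
... | false = refl

preimage : (Fin m → Fin n) → Subset n → Subset m
preimage φ S = tabulate (lookup S ∘ φ)

togetherCount-preimage : ∀ (φ : Fin m → Fin n) i j 𝒞 →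
  togetherCount i j (List.map (preimage φ) 𝒞) ≡ togetherCount (φ i) (φ j) 𝒞
togetherCount-preimage φ i j []      = refl
togetherCount-preimage φ i j (S ∷ 𝒞) = trans
  (togetherCount-∷ i j (preimage φ S) (List.map (preimage φ) 𝒞))
  (trans
    (cong₂ (λ b → if b then suc else id)
      (cong₂ _∧_ (lookup∘tabulate (lookup S ∘ φ) i) (lookup∘tabulate (lookup S ∘ φ) j))
      (togetherCount-preimage φ i j 𝒞))
    (sym (togetherCount-∷ (φ i) (φ j) S 𝒞)))

-- Pulling every set back along the embedding `φ` leaves the counts unchanged. Injectivity of `φ`
-- matters because a system constrains only distinct vertices.
HasSystemOfSize-induced : ∀ {G : Graph (Fin n)} {H : Graph (Fin m)} {k} S →
  induced G S ≅ H → HasSystemOfSize G k → HasSystemOfSize H k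
HasSystemOfSize-induced {n} {m} {G} {H} S (f , adj) (𝒞 , size , system) =
  List.map (preimage φ) 𝒞 , trans (length-map (preimage φ) 𝒞) size , λ i j i≢j →
    let module E = Equivalence (system (φ i) (φ j) (i≢j ∘ φ-injective))
        module A = Equivalence (φ-adj i j)
        count    = togetherCount-preimage φ i j 𝒞
    in mk⇔ (subst Odd (sym count) ∘ E.to ∘ A.from) (A.to ∘ E.from ∘ subst Odd count)
  where
  open Inverse f

  φ : Fin m → Fin n
  φ = proj₁ ∘ from

  φ-injective : ∀ {i j} → φ i ≡ φ j → i ≡ j
  φ-injective {i} {j} eq =
    trans (sym (strictlyInverseˡ i)) (trans (cong to (∈-proj₁-injective eq)) (strictlyInverseˡ j))

  φ-adj : ∀ i j → Adj G (φ i) (φ j) ⇔ Adj H i j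
  φ-adj i j = subst₂ (λ i′ j′ → Adj G (φ i) (φ j) ⇔ Adj H i′ j′)
    (strictlyInverseˡ i) (strictlyInverseˡ j) (adj (from i) (from j))

-- Decided by exhaustive search over graphs with at most six vertices. Every size below 3 is
-- searched because `HasSystemOfSize` fixes the length exactly.
𝓕-systemless : All (λ (_ , H) → ∀ {k} → k < 3 → ¬ HasSystemOfSize H k) 𝓕
𝓕-systemless = from-yes (All.all? (λ (_ , H) → allUpTo? (¬? ∘ hasSystemOfSize? H) 3) 𝓕)

c₂≤2⇒𝓕-free : (G : Graph (Fin n)) → c₂ G ≤ 2 → (𝓕 -free) G
c₂≤2⇒𝓕-free G c₂≤2 = All.map
  (λ { {_ , H} none S iso →
    none (s≤s c₂≤2) (HasSystemOfSize-induced {G = G} {H = H} S iso (proj₁ (c₂-least G))) })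
  𝓕-systemless

-- Decompositions

module _ (G : Graph (Fin n)) where

  private
    _~_ _≁_ : Fin n → Fin n → Set
    u ~ v = Adj G u v
    u ≁ v = ¬ u ~ v

  record Decomposition : Set₁ where
    field
      Left Right Centre  : Fin n → Set
      cover              : ∀ v → (∀ w → v ≁ w) ⊎ Left v ⊎ Right v ⊎ Centre v
      left-clique        : ∀ {u v} → Left u → Left v → u ≢ v → u ~ v
      right-clique       : ∀ {u v} → Right u → Right v → u ≢ v → u ~ v
      centre-independent : ∀ {u v} → Centre u → Centre v → u ≁ v
      left-right         : ∀ {u v} → Left u → Right v → u ≁ v
      left-centre        : ∀ {u v} → Left u → Centre v → u ~ v
      right-centre       : ∀ {u v} → Right u → Centre v → u ~ v

module _ {G : Graph (Fin n)} (D : Decomposition G) where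

  open Decomposition D

  private
    data Part : Set where
      outside left right centre : Part

    _∈ᵖ_ : Fin n → Part → Set
    v ∈ᵖ outside = ∀ w → ¬ Adj G v w
    v ∈ᵖ left    = Left v
    v ∈ᵖ right   = Right v
    v ∈ᵖ centre  = Centre v

    locate : ∀ v → ∃ (v ∈ᵖ_)
    locate v with cover v
    ... | inj₁ o               = outside , o
    ... | inj₂ (inj₁ l)        = left , l
    ... | inj₂ (inj₂ (inj₁ r)) = right , r
    ... | inj₂ (inj₂ (inj₂ c)) = centre , c

    in₁ in₂ : Part → Bool
    in₁ outside = false
    in₁ left    = true
    in₁ right   = false
    in₁ centre  = true
    in₂ outside = false
    in₂ left    = false
    in₂ right   = true
    in₂ centre  = true

    member : (Part → Bool) → Fin n → Bool
    member s v = s (proj₁ (locate v))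

    OddIn : Bool → Bool → Set
    OddIn a b = Odd ((if a then suc else id) ((if b then suc else id) 0))

    -- Two vertices share both sets inside the centre, one set inside a side or between a side and
    -- the centre, and none otherwise. `OddIn` computes to these parities.
    adjacency : ∀ p q {u v} → u ∈ᵖ p → v ∈ᵖ q → u ≢ v →
                Adj G u v ⇔ OddIn (in₁ p ∧ in₁ q) (in₂ p ∧ in₂ q)
    adjacency outside q       u∈ v∈ _   = mk⇔ (⊥-elim ∘ u∈ _) λ ()
    adjacency left    outside u∈ v∈ _   = mk⇔ (⊥-elim ∘ v∈ _ ∘ symmetric G) λ ()
    adjacency right   outside u∈ v∈ _   = mk⇔ (⊥-elim ∘ v∈ _ ∘ symmetric G) λ ()
    adjacency centre  outside u∈ v∈ _   = mk⇔ (⊥-elim ∘ v∈ _ ∘ symmetric G) λ ()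
    adjacency left    left    u∈ v∈ u≢v = mk⇔ (const refl) (const (left-clique u∈ v∈ u≢v))
    adjacency left    right   u∈ v∈ _   = mk⇔ (⊥-elim ∘ left-right u∈ v∈) λ ()
    adjacency left    centre  u∈ v∈ _   = mk⇔ (const refl) (const (left-centre u∈ v∈))
    adjacency right   left    u∈ v∈ _   = mk⇔ (⊥-elim ∘ left-right v∈ u∈ ∘ symmetric G) λ ()
    adjacency right   right   u∈ v∈ u≢v = mk⇔ (const refl) (const (right-clique u∈ v∈ u≢v))
    adjacency right   centre  u∈ v∈ _   = mk⇔ (const refl) (const (right-centre u∈ v∈))
    adjacency centre  left    u∈ v∈ _   = mk⇔ (const refl) (const (symmetric G (left-centre v∈ u∈)))
    adjacency centre  right   u∈ v∈ _   = mk⇔ (const refl) (const (symmetric G (right-centre v∈ u∈)))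
    adjacency centre  centre  u∈ v∈ _   = mk⇔ (⊥-elim ∘ centre-independent u∈ v∈) λ ()

  decomposition⇒system : HasSystemOfSize G 2
  decomposition⇒system = S₁ ∷ S₂ ∷ [] , refl , λ u v u≢v →
    subst (λ k → Adj G u v ⇔ Odd k) (sym (count u v))
      (adjacency (proj₁ (locate u)) (proj₁ (locate v)) (proj₂ (locate u)) (proj₂ (locate v)) u≢v)
    where
    S₁ S₂ : Subset n
    S₁ = tabulate (member in₁)
    S₂ = tabulate (member in₂)

    count : ∀ u v → togetherCount u v (S₁ ∷ S₂ ∷ []) ≡
      (if member in₁ u ∧ member in₁ v then suc else id)
        ((if member in₂ u ∧ member in₂ v then suc else id) 0)
    count u v
      rewrite togetherCount-∷ u v S₁ (S₂ ∷ []) | togetherCount-∷ u v S₂ []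
            | lookup∘tabulate (member in₁) u | lookup∘tabulate (member in₁) v
            | lookup∘tabulate (member in₂) u | lookup∘tabulate (member in₂) v = refl

-- Induced copies of a fixed graph

module _ (G : Graph (Fin n)) (H : Graph (Fin m)) where

  -- `S` is the image of `φ`; the inverse searches for a preimage, which is unique by injectivity.
  embedding⇒induced : (φ : Fin m → Fin n) → (∀ {i j} → φ i ≡ φ j → i ≡ j) →
    (∀ i j → Adj H i j ⇔ Adj G (φ i) (φ j)) → ∃ λ S → induced G S ≅ H
  embedding⇒induced φ injective adj =
    S , mk↔ₛ′ index vertex (λ i → injective (proj₂ (preimage-of (vertex i)))) vertex∘index ,
    λ u v → subst₂ (λ a b → Adj G a b ⇔ Adj H (index u) (index v))
      (proj₂ (preimage-of u)) (proj₂ (preimage-of v))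
      (mk⇔ (Equivalence.from (adj _ _)) (Equivalence.to (adj _ _)))
    where
    hit? : ∀ v → Dec (∃ λ i → φ i ≡ v)
    hit? v = any? λ i → φ i ≟ v

    S : Subset n
    S = tabulate (does ∘ hit?)

    preimage-of : (u : ∃ λ v → v ∈ S) → ∃ λ i → φ i ≡ proj₁ u
    -- The second expression equates `does (hit? v)` with `true`, leaving only the `yes` case.
    preimage-of (v , v∈S) with hit? v | trans (sym (lookup∘tabulate (does ∘ hit?) v)) ([]=⇒lookup v∈S)
    ... | yes hit | _ = hit

    index : (∃ λ v → v ∈ S) → Fin m
    index = proj₁ ∘ preimage-of

    vertex : Fin m → ∃ λ v → v ∈ S
    vertex i = φ i , lookup⇒[]= (φ i) S
      (trans (lookup∘tabulate (does ∘ hit?) (φ i)) (dec-true (hit? (φ i)) (i , refl)))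

    vertex∘index : ∀ u → vertex (index u) ≡ u
    vertex∘index u = ∈-proj₁-injective (proj₂ (preimage-of u))

  private
    twins? : ∀ i j → Dec (∀ k → does (adj? H i k) ≡ does (adj? H j k))
    twins? i j = all? λ k → does (adj? H i k) Bool.≟ does (adj? H j k)

  -- Vertices that H itself separates are automatically distinct, so
  -- distinctness is only asked of twins.

  Link : ∀ {A T : Set} → Dec A → Dec T → Fin n → Fin n → Set
  Link adjacent? twins? u v =
    if does adjacent? then Adj G u v
    else if does twins? then u ≢ v × ¬ Adj G u v
    else ¬ Adj G u v

  Entry : Vec (Fin n) m → Fin m → Fin m → Set
  Entry vs i j = Link (adj? H i j) (twins? i j) (lookup vs i) (lookup vs j)

  -- For a concrete `H` the entries compute to literal facts about `G`, so a table is a triangle: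
  -- row `i` treats the pairs of `i` with each later `j`.
  Table : Vec (Fin n) m → Set
  Table vs = AllPairs (Entry vs) (allFin m)

  private
    related : ∀ {A : Set} {R : A → A → Set} {xs} → AllPairs R xs →
              ∀ {x y} → x ∈ₗ xs → y ∈ₗ xs → x ≢ y → R x y ⊎ R y x
    related (_ ∷ _)  (here refl) (here refl) x≢y = contradiction refl x≢y
    related (r ∷ _)  (here refl) (there y∈)  _   = inj₁ (All.lookup r y∈)
    related (r ∷ _)  (there x∈)  (here refl) _   = inj₂ (All.lookup r x∈)
    related (_ ∷ rs) (there x∈)  (there y∈)  x≢y = related rs x∈ y∈ x≢y

    link-adj : ∀ {A T : Set} (a? : Dec A) (t? : Dec T) {u v} → Link a? t? u v → A ⇔ Adj G u v
    link-adj (yes a) _       uv        = mk⇔ (const uv) (const a)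
    link-adj (no ¬a) (yes _) (_ , ¬uv) = mk⇔ (⊥-elim ∘ ¬a) (⊥-elim ∘ ¬uv)
    link-adj (no ¬a) (no _)  ¬uv       = mk⇔ (⊥-elim ∘ ¬a) (⊥-elim ∘ ¬uv)

    -- Equality would give, branch by branch, a loop, a clash with the recorded `≢`, or twins in
    -- `H`.
    link-distinct : ∀ {A T : Set} (a? : Dec A) (t? : Dec T) {u v} →
                    Link a? t? u v → (u ≡ v → T) → u ≢ v
    link-distinct (yes _) _       uv        _    refl = loopless G _ uv
    link-distinct (no _)  (yes _) (u≢v , _) _    u≡v  = u≢v u≡v
    link-distinct (no _)  (no ¬t) _         twin u≡v  = ¬t (twin u≡v)

  table⇒induced : ∀ {vs} → Table vs → ∃ λ S → induced G S ≅ H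
  table⇒induced {vs} table = embedding⇒induced (lookup vs) injective adj
    where
    adj : ∀ i j → Adj H i j ⇔ Adj G (lookup vs i) (lookup vs j)
    adj i j with i ≟ j
    ... | yes refl = mk⇔ (⊥-elim ∘ loopless H i) (⊥-elim ∘ loopless G _)
    ... | no i≢j with related table (∈-allFin i) (∈-allFin j) i≢j
    ...   | inj₁ e = link-adj (adj? H i j) (twins? i j) e
    ...   | inj₂ e = let module E = Equivalence (link-adj (adj? H j i) (twins? j i) e)
                     in mk⇔ (symmetric G ∘ E.to ∘ symmetric H) (symmetric H ∘ E.from ∘ symmetric G)

    -- `adj` is obtained without injectivity, so vertices of `H` with a common image have the same
    -- neighbours in `H`.
    collapsed⇒twins : ∀ i j → lookup vs i ≡ lookup vs j → ∀ k → does (adj? H i k) ≡ does (adj? H j k)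
    collapsed⇒twins i j eq k = does-⇔ (mk⇔
      (Equivalence.from (adj j k) ∘ subst (λ u → Adj G u (lookup vs k)) eq ∘ Equivalence.to (adj i k))
      (Equivalence.from (adj i k) ∘ subst (λ u → Adj G u (lookup vs k)) (sym eq) ∘ Equivalence.to (adj j k)))
      (adj? H i k) (adj? H j k)

    injective : ∀ {i j} → lookup vs i ≡ lookup vs j → i ≡ j
    injective {i} {j} eq with i ≟ j
    ... | yes i≡j = i≡j
    ... | no i≢j with related table (∈-allFin i) (∈-allFin j) i≢j
    ...   | inj₁ e = ⊥-elim (link-distinct (adj? H i j) (twins? i j) e (collapsed⇒twins i j) eq)
    ...   | inj₂ e = ⊥-elim (link-distinct (adj? H j i) (twins? j i) e (collapsed⇒twins j i) (sym eq))

-- Decomposing an 𝓕-free graph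

module _ (G : Graph (Fin n)) (free : (𝓕 -free) G) where

  private
    infix 4 _~_ _≁_ _~?_

    _~_ _≁_ : Fin n → Fin n → Set
    u ~ v = Adj G u v
    u ≁ v = ¬ u ~ v

    _~?_ : ∀ u v → Dec (u ~ v)
    _~?_ = adj? G

    ~-sym : ∀ {u v} → u ~ v → v ~ u
    ~-sym = symmetric G

    ≁-sym : ∀ {u v} → u ≁ v → v ≁ u
    ≁-sym = _∘ symmetric G

    ~⇒≢ : ∀ {u v} → u ~ v → u ≢ v
    ~⇒≢ u~v refl = loopless G _ u~v

    -- Decidability lets an edge be proved by refuting its absence, which is what the forbidden
    -- graphs provide.
    ~-stable : ∀ {u v} → ¬ u ≁ v → u ~ v
    ~-stable = decidable-stable (_ ~? _)

    -- `vs` lists the images of the vertices of `H` in order, so each use below spells out the copy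
    -- vertex by vertex.
    excluded : ∀ {m} {H : Graph (Fin m)} → (m , H) ∈ₗ 𝓕 → ∀ vs → ¬ Table G H vs
    excluded {H = H} H∈𝓕 vs table with table⇒induced G H {vs} table
    ... | S , iso = All.lookup free H∈𝓕 S iso

  no-P₄        = excluded {H = P 4} (here refl)
  no-P₃+K₂     = excluded {H = P 3 ⊕ K 2} (there (here refl))
  no-3K₂       = excluded {H = K 2 ⊕ K 2 ⊕ K 2} (there (there (here refl)))
  no-fullHouse = excluded {H = fullHouse} (there (there (there (here refl))))
  no-dart      = excluded {H = dart} (there (there (there (there (here refl)))))
  no-⋉         = excluded {H = ⋉} (there (there (there (there (there (here refl))))))
  no-K₃₃       = excluded {H = K[ 3 , 3 ]} (there (there (there (there (there (there (here refl)))))))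
  no-W₅        = excluded {H = W₅} (there (there (there (there (there (there (there (here refl))))))))

  InducedP₃ : Fin n → Fin n → Fin n → Set
  InducedP₃ x y z = x ~ y × y ~ z × x ≢ z × x ≁ z

  inducedP₃? : ∀ x y z → Dec (InducedP₃ x y z)
  inducedP₃? x y z = (x ~? y) ×-dec (y ~? z) ×-dec ¬? (x ≟ z) ×-dec ¬? (x ~? z)

  reverse : ∀ {x y z} → InducedP₃ x y z → InducedP₃ z y x
  reverse (xy , yz , x≢z , x≁z) = ~-sym yz , ~-sym xy , ≢-sym x≢z , ≁-sym x≁z

  unextendable : ∀ {x y z} → InducedP₃ x y z → ∀ {v} → v ~ x → v ≁ y → v ≁ z → ⊥
  unextendable {x} {y} {z} (xy , yz , _ , x≁z) {v} vx v≁y v≁z = no-P₄ (v ∷ x ∷ y ∷ z ∷ [])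
    ((vx ∷ v≁y ∷ v≁z ∷ []) ∷ (xy ∷ x≁z ∷ []) ∷ (yz ∷ []) ∷ [] ∷ [])

  -- Unless `w` sees all or none of the path, some path edge has exactly one end adjacent to `w` and
  -- forms `P 4` with `v` and `w`. Seeing none gives `P 3 ⊕ K 2`; seeing all gives a dart with
  -- pendant `v`.
  remote⇒isolated : ∀ {x y z} → InducedP₃ x y z → ∀ {v} → v ≁ x → v ≁ y → v ≁ z → ∀ w → v ≁ w
  remote⇒isolated {x} {y} {z} (xy , yz , x≢z , x≁z) {v} v≁x v≁y v≁z w vw
    with w ~? y | w ~? x | w ~? z
  ... | no w≁y | yes wx | _      = no-P₄ (v ∷ w ∷ x ∷ y ∷ [])
    ((vw ∷ v≁x ∷ v≁y ∷ []) ∷ (wx ∷ w≁y ∷ []) ∷ (xy ∷ []) ∷ [] ∷ [])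
  ... | no w≁y | no _   | yes wz = no-P₄ (v ∷ w ∷ z ∷ y ∷ [])
    ((vw ∷ v≁z ∷ v≁y ∷ []) ∷ (wz ∷ w≁y ∷ []) ∷ (~-sym yz ∷ []) ∷ [] ∷ [])
  ... | no w≁y | no w≁x | no w≁z = no-P₃+K₂ (x ∷ y ∷ z ∷ v ∷ w ∷ [])
    ( (xy ∷ (x≢z , x≁z) ∷ ≁-sym v≁x ∷ ≁-sym w≁x ∷ [])
    ∷ (yz ∷ ≁-sym v≁y ∷ ≁-sym w≁y ∷ []) ∷ (≁-sym v≁z ∷ ≁-sym w≁z ∷ []) ∷ (vw ∷ []) ∷ [] ∷ [])
  ... | yes wy | no w≁x | _      = no-P₄ (v ∷ w ∷ y ∷ x ∷ [])
    ((vw ∷ v≁y ∷ v≁x ∷ []) ∷ (wy ∷ w≁x ∷ []) ∷ (~-sym xy ∷ []) ∷ [] ∷ [])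
  ... | yes wy | yes _  | no w≁z = no-P₄ (v ∷ w ∷ y ∷ z ∷ [])
    ((vw ∷ v≁y ∷ v≁z ∷ []) ∷ (wy ∷ w≁z ∷ []) ∷ (yz ∷ []) ∷ [] ∷ [])
  ... | yes wy | yes wx | yes wz = no-dart (y ∷ w ∷ v ∷ x ∷ z ∷ [])
    ( (~-sym wy ∷ ≁-sym v≁y ∷ ~-sym xy ∷ yz ∷ [])
    ∷ (~-sym vw ∷ wx ∷ wz ∷ []) ∷ (v≁x ∷ v≁z ∷ []) ∷ ((x≢z , x≁z) ∷ []) ∷ [] ∷ [])

  -- With x ≁ z both adjacent to y, a further neighbour w of y completes an
  -- induced claw or an induced diamond in which x and z are twins.

  Fourth : Fin n → Fin n → Fin n → Fin n → Set
  Fourth x y z w = w ~ y × w ≢ x × w ≢ z × (w ≁ x × w ≁ z ⊎ w ~ x × w ~ z)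

  fourth? : ∀ x y z w → Dec (Fourth x y z w)
  fourth? x y z w = (w ~? y) ×-dec ¬? (w ≟ x) ×-dec ¬? (w ≟ z) ×-dec
    (¬? (w ~? x) ×-dec ¬? (w ~? z) ⊎-dec (w ~? x) ×-dec (w ~? z))

  reverse-fourth : ∀ {x y z w} → Fourth x y z w → Fourth z y x w
  reverse-fourth (wy , w≢x , w≢z , inj₁ (w≁x , w≁z)) = wy , w≢z , w≢x , inj₁ (w≁z , w≁x)
  reverse-fourth (wy , w≢x , w≢z , inj₂ (wx , wz))   = wy , w≢z , w≢x , inj₂ (wz , wx)

  -- According to whether `v ~ w`, the claw yields a dart or `⋉`, and the diamond a full house or
  -- `P 4`.
  one-sided : ∀ {x y z w v} → InducedP₃ x y z → Fourth x y z w → v ~ x → v ~ y → v ≁ z → ⊥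
  one-sided {x} {y} {z} {w} {v} (xy , yz , x≢z , x≁z) (wy , w≢x , w≢z , inj₁ (w≁x , w≁z)) vx vy v≁z
    with v ~? w
  ... | yes vw = no-dart (v ∷ y ∷ z ∷ x ∷ w ∷ [])
    ( (vy ∷ v≁z ∷ vx ∷ vw ∷ []) ∷ (yz ∷ ~-sym xy ∷ ~-sym wy ∷ [])
    ∷ (≁-sym x≁z ∷ ≁-sym w≁z ∷ []) ∷ ((≢-sym w≢x , ≁-sym w≁x) ∷ []) ∷ [] ∷ [])
  ... | no v≁w = no-⋉ (v ∷ x ∷ y ∷ z ∷ w ∷ [])
    ( (vx ∷ vy ∷ v≁z ∷ v≁w ∷ []) ∷ (xy ∷ x≁z ∷ ≁-sym w≁x ∷ [])
    ∷ (yz ∷ ~-sym wy ∷ []) ∷ ((≢-sym w≢z , ≁-sym w≁z) ∷ []) ∷ [] ∷ [])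
  one-sided {x} {y} {z} {w} {v} (xy , yz , x≢z , x≁z) (wy , _ , _ , inj₂ (wx , wz)) vx vy v≁z
    with v ~? w
  ... | yes vw = no-fullHouse (z ∷ y ∷ v ∷ x ∷ w ∷ [])
    ( (~-sym yz ∷ ≁-sym v≁z ∷ ≁-sym x≁z ∷ ~-sym wz ∷ [])
    ∷ (~-sym vy ∷ ~-sym xy ∷ ~-sym wy ∷ []) ∷ (vx ∷ vw ∷ []) ∷ (~-sym wx ∷ []) ∷ [] ∷ [])
  ... | no v≁w = no-P₄ (v ∷ x ∷ w ∷ z ∷ [])
    ((vx ∷ v≁w ∷ v≁z ∷ []) ∷ (~-sym wx ∷ x≁z ∷ []) ∷ (wz ∷ []) ∷ [] ∷ [])

  -- Graphs with an induced claw or diamond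

  module _ {x y z w} (p : InducedP₃ x y z) (four : Fourth x y z w) where

    private
      xy  = proj₁ p
      yz  = proj₁ (proj₂ p)
      x≢z = proj₁ (proj₂ (proj₂ p))
      x≁z = proj₂ (proj₂ (proj₂ p))

      -- By irreflexivity `x` and `z` are leaves, while `y` has the adjacencies of an antipode;
      -- hence `y` is named in `Hub` and barred from `Antipode`.
      Hub Antipode Leaf : Fin n → Set
      Hub v      = v ≡ y ⊎ (v ~ x × v ~ y × v ~ z)
      Antipode v = v ≢ y × v ~ x × v ≁ y × v ~ z
      Leaf v     = v ≁ x × v ~ y × v ≁ z

    private
      -- Of the eight adjacency patterns to the path, four are removed by `one-sided` and
      -- `unextendable`, each used in both directions of the path.
      cover : ∀ v → (∀ u → v ≁ u) ⊎ Hub v ⊎ Antipode v ⊎ Leaf v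
      cover v with v ≟ y | v ~? x | v ~? y | v ~? z
      ... | yes v≡y | _      | _      | _      = inj₂ (inj₁ (inj₁ v≡y))
      ... | no _    | yes vx | yes vy | yes vz = inj₂ (inj₁ (inj₂ (vx , vy , vz)))
      ... | no v≢y  | yes vx | no v≁y | yes vz = inj₂ (inj₂ (inj₁ (v≢y , vx , v≁y , vz)))
      ... | no _    | no v≁x | yes vy | no v≁z = inj₂ (inj₂ (inj₂ (v≁x , vy , v≁z)))
      ... | no _    | no v≁x | no v≁y | no v≁z = inj₁ (remote⇒isolated p v≁x v≁y v≁z)
      ... | no _    | yes vx | yes vy | no v≁z = ⊥-elim (one-sided p four vx vy v≁z)
      ... | no _    | no v≁x | yes vy | yes vz = ⊥-elim (one-sided (reverse p) (reverse-fourth four) vz vy v≁x)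
      ... | no _    | yes vx | no v≁y | no v≁z = ⊥-elim (unextendable p vx v≁y v≁z)
      ... | no _    | no v≁x | no v≁y | yes vz = ⊥-elim (unextendable (reverse p) vz v≁y v≁x)

      -- Nonadjacent hubs other than `y` would form the rim `x u z v` of a `W₅` centred at `y`.
      hubs-adjacent : ∀ {u v} → Hub u → Hub v → u ≢ v → u ~ v
      hubs-adjacent (inj₁ refl) (inj₁ refl) u≢v = contradiction refl u≢v
      hubs-adjacent (inj₁ refl) (inj₂ (_ , vy , _)) _ = ~-sym vy
      hubs-adjacent (inj₂ (_ , uy , _)) (inj₁ refl) _ = uy
      hubs-adjacent {u} {v} (inj₂ (ux , uy , uz)) (inj₂ (vx , vy , vz)) u≢v = ~-stable λ u≁v →
        no-W₅ (x ∷ u ∷ z ∷ v ∷ y ∷ [])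
          ( (~-sym ux ∷ (x≢z , x≁z) ∷ ~-sym vx ∷ xy ∷ []) ∷ (uz ∷ (u≢v , u≁v) ∷ uy ∷ [])
          ∷ (~-sym vz ∷ ~-sym yz ∷ []) ∷ (vy ∷ []) ∷ [] ∷ [])

      leaves-independent : ∀ {u v} → Leaf u → Leaf v → u ≁ v
      leaves-independent {u} {v} (u≁x , uy , u≁z) (v≁x , vy , v≁z) uv =
        no-⋉ (u ∷ v ∷ y ∷ x ∷ z ∷ [])
          ( (uv ∷ uy ∷ u≁x ∷ u≁z ∷ []) ∷ (vy ∷ v≁x ∷ v≁z ∷ [])
          ∷ (~-sym xy ∷ yz ∷ []) ∷ ((x≢z , x≁z) ∷ []) ∷ [] ∷ [])

      -- With an antipode `v` the vertices `x y z v` form a 4-cycle; a hub other than `y` adjacent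
      -- to `v` would complete a `W₅`.
      hub-antipode : ∀ {u v} → Hub u → Antipode v → u ≁ v
      hub-antipode (inj₁ refl) (_ , _ , v≁y , _) = ≁-sym v≁y
      hub-antipode {u} {v} (inj₂ (ux , uy , uz)) (v≢y , vx , v≁y , vz) uv =
        no-W₅ (x ∷ y ∷ z ∷ v ∷ u ∷ [])
          ( (xy ∷ (x≢z , x≁z) ∷ ~-sym vx ∷ ~-sym ux ∷ [])
          ∷ (yz ∷ (≢-sym v≢y , ≁-sym v≁y) ∷ ~-sym uy ∷ [])
          ∷ (~-sym vz ∷ ~-sym uz ∷ []) ∷ (~-sym uv ∷ []) ∷ [] ∷ [])

      hub-leaf : ∀ {u v} → Hub u → Leaf v → u ~ v
      hub-leaf (inj₁ refl) (_ , vy , _) = ~-sym vy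
      hub-leaf {u} {v} (inj₂ (ux , uy , uz)) (v≁x , vy , v≁z) = ~-stable λ u≁v →
        no-dart (u ∷ y ∷ v ∷ x ∷ z ∷ [])
          ( (uy ∷ u≁v ∷ ux ∷ uz ∷ []) ∷ (~-sym vy ∷ ~-sym xy ∷ yz ∷ [])
          ∷ (v≁x ∷ v≁z ∷ []) ∷ ((x≢z , x≁z) ∷ []) ∷ [] ∷ [])

      antipode-leaf : ∀ {u v} → Antipode u → Leaf v → u ~ v
      antipode-leaf {u} {v} (_ , ux , u≁y , _) (v≁x , vy , _) = ~-stable λ u≁v →
        no-P₄ (v ∷ y ∷ x ∷ u ∷ [])
          ((vy ∷ v≁x ∷ ≁-sym u≁v ∷ []) ∷ (~-sym xy ∷ ≁-sym u≁y ∷ []) ∷ (~-sym ux ∷ []) ∷ [] ∷ [])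

      -- In a claw `w` is a third leaf, so nonadjacent antipodes together with `y` face `x`, `z`,
      -- `w` in a `K[ 3 , 3 ]`. In a diamond `w` is a hub, and the antipodes hang from `x` on the
      -- triangle `y w x`, giving `⋉`.
      antipodes-adjacent : Fourth x y z w → ∀ {u v} → Antipode u → Antipode v → u ≢ v → u ~ v
      antipodes-adjacent (wy , w≢x , w≢z , inj₁ (w≁x , w≁z))
        {u} {v} au@(u≢y , ux , u≁y , uz) av@(v≢y , vx , v≁y , vz) u≢v = ~-stable λ u≁v →
        no-K₃₃ (y ∷ u ∷ v ∷ x ∷ z ∷ w ∷ [])
          ( ((≢-sym u≢y , ≁-sym u≁y) ∷ (≢-sym v≢y , ≁-sym v≁y) ∷ ~-sym xy ∷ yz ∷ ~-sym wy ∷ [])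
          ∷ ((u≢v , u≁v) ∷ ux ∷ uz ∷ antipode-leaf au (w≁x , wy , w≁z) ∷ [])
          ∷ (vx ∷ vz ∷ antipode-leaf av (w≁x , wy , w≁z) ∷ [])
          ∷ ((x≢z , x≁z) ∷ (≢-sym w≢x , ≁-sym w≁x) ∷ [])
          ∷ ((≢-sym w≢z , ≁-sym w≁z) ∷ []) ∷ [] ∷ [])
      antipodes-adjacent (wy , _ , _ , inj₂ (wx , wz))
        {u} {v} au@(_ , ux , u≁y , _) av@(_ , vx , v≁y , _) u≢v = ~-stable λ u≁v →
        no-⋉ (y ∷ w ∷ x ∷ u ∷ v ∷ [])
          ( (~-sym wy ∷ ~-sym xy ∷ ≁-sym u≁y ∷ ≁-sym v≁y ∷ [])
          ∷ (wx ∷ hub-antipode (inj₂ (wx , wy , wz)) au ∷ hub-antipode (inj₂ (wx , wy , wz)) av ∷ [])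
          ∷ (~-sym ux ∷ ~-sym vx ∷ []) ∷ ((u≢v , u≁v) ∷ []) ∷ [] ∷ [])

    fourth⇒decomposition : Decomposition G
    fourth⇒decomposition = record
      { Left               = Hub
      ; Right              = Antipode
      ; Centre             = Leaf
      ; cover              = cover
      ; left-clique        = hubs-adjacent
      ; right-clique       = antipodes-adjacent four
      ; centre-independent = leaves-independent
      ; left-right         = hub-antipode
      ; left-centre        = hub-leaf
      ; right-centre       = antipode-leaf
      }

  -- Graphs with an induced path but no induced claw or diamond

  module _ {x y z} (p : InducedP₃ x y z)
           (no-fourth : ∀ {x y z w} → InducedP₃ x y z → ¬ Fourth x y z w) where

    private
      -- The ends are parameters shadowing those of the module, so that reversing the path exchanges
      -- the sides and one lemma serves both.
      Side : Fin n → Fin n → Fin n → Set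
      Side x z v = v ≡ x ⊎ (v ~ x × v ~ y × v ≁ z)

      Middle : Fin n → Fin n → Fin n → Set
      Middle x z v = v ~ x × v ≁ y × v ~ z

      -- A missing edge between `u` and `v` leaves a diamond on `x y u v` with `z` pendant at `y`: a
      -- dart.
      side-clique : ∀ {x z u v} → InducedP₃ x y z → Side x z u → Side x z v → u ≢ v → u ~ v
      side-clique _ (inj₁ refl) (inj₁ refl) u≢v = contradiction refl u≢v
      side-clique _ (inj₁ refl) (inj₂ (vx , _)) _ = ~-sym vx
      side-clique _ (inj₂ (ux , _)) (inj₁ refl) _ = ux
      side-clique {x} {z} {u} {v} (xy , yz , _ , x≁z) (inj₂ (ux , uy , u≁z)) (inj₂ (vx , vy , v≁z)) u≢v =
        ~-stable λ u≁v → no-dart (x ∷ y ∷ z ∷ u ∷ v ∷ [])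
          ( (xy ∷ x≁z ∷ ~-sym ux ∷ ~-sym vx ∷ []) ∷ (yz ∷ ~-sym uy ∷ ~-sym vy ∷ [])
          ∷ (≁-sym u≁z ∷ ≁-sym v≁z ∷ []) ∷ ((u≢v , u≁v) ∷ []) ∷ [] ∷ [])

      sides-apart : ∀ {u v} → Side x z u → Side z x v → u ≁ v
      sides-apart (inj₁ refl) (inj₁ refl) = proj₂ (proj₂ (proj₂ p))
      sides-apart (inj₁ refl) (inj₂ (_ , _ , v≁x)) = ≁-sym v≁x
      sides-apart (inj₂ (_ , _ , u≁z)) (inj₁ refl) = u≁z
      sides-apart {u} {v} (inj₂ (ux , _ , u≁z)) (inj₂ (vz , _ , v≁x)) uv =
        no-P₄ (x ∷ u ∷ v ∷ z ∷ [])
          ((~-sym ux ∷ ≁-sym v≁x ∷ proj₂ (proj₂ (proj₂ p)) ∷ []) ∷ (uv ∷ u≁z ∷ []) ∷ (vz ∷ []) ∷ [] ∷ [])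

      side-middle : ∀ {x z u v} → InducedP₃ x y z → Side x z u → Middle x z v → u ~ v
      side-middle _ (inj₁ refl) (vx , _) = ~-sym vx
      side-middle {x} {z} {u} {v} (_ , yz , _) (inj₂ (_ , uy , u≁z)) (_ , v≁y , vz) =
        ~-stable λ u≁v → no-P₄ (u ∷ y ∷ z ∷ v ∷ [])
          ((uy ∷ u≁z ∷ u≁v ∷ []) ∷ (yz ∷ ≁-sym v≁y ∷ []) ∷ (~-sym vz ∷ []) ∷ [] ∷ [])

      -- An edge makes `v` a fourth vertex for the path `x – u – z`, not for the given one; hence
      -- `no-fourth` ranges over all induced paths.
      middle-independent : ∀ {u v} → Middle x z u → Middle x z v → u ≁ v
      middle-independent (ux , _ , uz) (vx , _ , vz) uv =
        no-fourth (~-sym ux , uz , proj₂ (proj₂ p))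
          (~-sym uv , ~⇒≢ vx , ~⇒≢ vz , inj₂ (vx , vz))

      cover : ∀ v → (∀ u → v ≁ u) ⊎ Side x z v ⊎ Side z x v ⊎ Middle x z v
      cover v with v ≟ x | v ≟ z | v ~? x | v ~? y | v ~? z
      ... | yes v≡x | _       | _      | _      | _      = inj₂ (inj₁ (inj₁ v≡x))
      ... | _       | yes v≡z | _      | _      | _      = inj₂ (inj₂ (inj₁ (inj₁ v≡z)))
      ... | _       | _       | yes vx | yes vy | no v≁z = inj₂ (inj₁ (inj₂ (vx , vy , v≁z)))
      ... | _       | _       | no v≁x | yes vy | yes vz = inj₂ (inj₂ (inj₁ (inj₂ (vz , vy , v≁x))))
      ... | _       | _       | yes vx | no v≁y | yes vz = inj₂ (inj₂ (inj₂ (vx , v≁y , vz)))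
      ... | _       | _       | no v≁x | no v≁y | no v≁z = inj₁ (remote⇒isolated p v≁x v≁y v≁z)
      -- The comparisons with `x` and `z` matter here: both ends show this same adjacency pattern.
      ... | no v≢x  | no v≢z  | no v≁x | yes vy | no v≁z = ⊥-elim (no-fourth p (vy , v≢x , v≢z , inj₁ (v≁x , v≁z)))
      ... | no v≢x  | no v≢z  | yes vx | yes vy | yes vz = ⊥-elim (no-fourth p (vy , v≢x , v≢z , inj₂ (vx , vz)))
      ... | _       | _       | yes vx | no v≁y | no v≁z = ⊥-elim (unextendable p vx v≁y v≁z)
      ... | _       | _       | no v≁x | no v≁y | yes vz = ⊥-elim (unextendable (reverse p) vz v≁y v≁x)

    no-fourth⇒decomposition : Decomposition G
    no-fourth⇒decomposition = record
      { Left               = Side x z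
      ; Right              = Side z x
      ; Centre             = Middle x z
      ; cover              = cover
      ; left-clique        = side-clique p
      ; right-clique       = side-clique (reverse p)
      ; centre-independent = middle-independent
      ; left-right         = sides-apart
      ; left-centre        = side-middle p
      ; right-centre       = λ s (vx , v≁y , vz) → side-middle (reverse p) s (vz , v≁y , vx)
      }

  -- Disjoint unions of cliques

  edgeless⇒decomposition : (∀ u v → u ≁ v) → Decomposition G
  edgeless⇒decomposition edgeless = record
    { Left               = λ _ → ⊥
    ; Right              = λ _ → ⊥
    ; Centre             = λ _ → ⊥
    ; cover              = inj₁ ∘ edgeless
    ; left-clique        = λ ()
    ; right-clique       = λ ()
    ; centre-independent = λ ()
    ; left-right         = λ ()
    ; left-centre        = λ ()
    ; right-centre       = λ ()
    }

  module _ (no-path : ∀ {x y z} → ¬ InducedP₃ x y z) where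

    private
      _≃_ : Fin n → Fin n → Set
      u ≃ v = u ≡ v ⊎ u ~ v

      ≃-sym : ∀ {u v} → u ≃ v → v ≃ u
      ≃-sym (inj₁ u≡v) = inj₁ (sym u≡v)
      ≃-sym (inj₂ uv)  = inj₂ (~-sym uv)

      -- Transitivity is the absence of induced paths on three vertices; the classes of `≃` are
      -- therefore cliques with no edges between them.
      ≃-trans : ∀ {u v w} → u ≃ v → v ≃ w → u ≃ w
      ≃-trans (inj₁ refl) vw          = vw
      ≃-trans (inj₂ uv)   (inj₁ refl) = inj₂ uv
      ≃-trans {u} {v} {w} (inj₂ uv) (inj₂ vw) with u ≟ w
      ... | yes u≡w = inj₁ u≡w
      ... | no u≢w  = inj₂ (~-stable λ u≁w → no-path (uv , vw , u≢w , u≁w))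

      -- Any edge between the two pairs would link `a` to `c` through `≃-trans`.
      edges-apart : ∀ {a b c d} → a ~ b → c ~ d → ¬ a ≃ c → a ≁ c × a ≁ d × b ≁ c × b ≁ d
      edges-apart ab cd a≄c =
          a≄c ∘ inj₂
        , (λ ad → a≄c (≃-trans (inj₂ ad) (inj₂ (~-sym cd))))
        , (λ bc → a≄c (≃-trans (inj₂ ab) (inj₂ bc)))
        , (λ bd → a≄c (≃-trans (inj₂ ab) (≃-trans (inj₂ bd) (inj₂ (~-sym cd)))))

    -- The clique of `p` is one side; all other non-isolated vertices form the second side, and the
    -- centre is empty.
    no-path⇒decomposition : ∀ {p q} → p ~ q → Decomposition G
    no-path⇒decomposition {p} {q} pq = record
      { Left               = _≃ p
      ; Right              = λ v → ¬ v ≃ p × ∃ (v ~_)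
      ; Centre             = λ _ → ⊥
      ; cover              = cover
      ; left-clique        = λ u≃p v≃p → adjacent (≃-trans u≃p (≃-sym v≃p))
      ; right-clique       = right-clique
      ; centre-independent = λ ()
      ; left-right         = λ u≃p (v≄p , _) uv → v≄p (≃-trans (inj₂ (~-sym uv)) u≃p)
      ; left-centre        = λ _ ()
      ; right-centre       = λ _ ()
      }
      where
      adjacent : ∀ {u v} → u ≃ v → u ≢ v → u ~ v
      adjacent (inj₁ u≡v) u≢v = contradiction u≡v u≢v
      adjacent (inj₂ uv)  _   = uv

      cover : ∀ v → (∀ w → v ≁ w) ⊎ v ≃ p ⊎ (¬ v ≃ p × ∃ (v ~_)) ⊎ ⊥
      cover v with (v ≟ p) ⊎-dec (v ~? p) | any? (v ~?_)
      ... | yes v≃p | _       = inj₂ (inj₁ v≃p)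
      ... | no v≄p  | yes vw  = inj₂ (inj₂ (inj₁ (v≄p , vw)))
      ... | no _    | no none = inj₁ λ w vw → none (w , vw)

      -- If `u` and `v` were not adjacent, the edges `p q`, `u u′` and `v v′` would lie in three
      -- different cliques and form `3K₂`.
      right-clique : ∀ {u v} → ¬ u ≃ p × ∃ (u ~_) → ¬ v ≃ p × ∃ (v ~_) → u ≢ v → u ~ v
      right-clique {u} {v} (u≄p , u′ , uu′) (v≄p , v′ , vv′) u≢v = ~-stable λ u≁v →
        let p≁u , p≁u′ , q≁u , q≁u′ = edges-apart pq uu′ (u≄p ∘ ≃-sym)
            p≁v , p≁v′ , q≁v , q≁v′ = edges-apart pq vv′ (v≄p ∘ ≃-sym)
            _ , u≁v′ , u′≁v , u′≁v′ = edges-apart uu′ vv′ λ u≃v → u≁v (adjacent u≃v u≢v)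
        in no-3K₂ (p ∷ q ∷ u ∷ u′ ∷ v ∷ v′ ∷ [])
          ( (pq ∷ p≁u ∷ p≁u′ ∷ p≁v ∷ p≁v′ ∷ []) ∷ (q≁u ∷ q≁u′ ∷ q≁v ∷ q≁v′ ∷ [])
          ∷ (uu′ ∷ u≁v ∷ u≁v′ ∷ []) ∷ (u′≁v ∷ u′≁v′ ∷ []) ∷ (vv′ ∷ []) ∷ [] ∷ [])

  𝓕-free⇒decomposition : Decomposition G
  𝓕-free⇒decomposition
    -- The fourth vertex is sought over all induced paths first, so failure supplies `no-fourth` for
    -- every path.
    with any? (λ x → any? λ y → any? λ z → any? λ w → inducedP₃? x y z ×-dec fourth? x y z w)
  ... | yes (_ , _ , _ , _ , p , four) = fourth⇒decomposition p four
  ... | no no-fourth with any? (λ x → any? λ y → any? λ z → inducedP₃? x y z)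
  ...   | yes (_ , _ , _ , p) =
    no-fourth⇒decomposition p λ p four → no-fourth (_ , _ , _ , _ , p , four)
  ...   | no no-path with any? (λ p → any? λ q → p ~? q)
  ...     | yes (_ , _ , pq) = no-path⇒decomposition (λ p → no-path (_ , _ , _ , p)) pq
  ...     | no edgeless      = edgeless⇒decomposition λ u v uv → edgeless (u , v , uv)

theorem5p5 : ∀ {n : ℕ} (G : Graph (Fin n)) → (c₂ G ≤ 2) ⇔ (𝓕 -free) G
theorem5p5 G = mk⇔ (c₂≤2⇒𝓕-free G) λ free →
  proj₂ (c₂-least G) 2 (decomposition⇒system (𝓕-free⇒decomposition G free))
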